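{- Let $\varphi$ be an $\mathrm{LTL}_{\mathcal T}$ specification and let $\varphi_{\mathbb B}$ be its Boolean abstraction, with Boolean environment variables $e$ and Boolean system variables $s$. If there is some unrolling depth $k\ge1$ such that the quantified Boolean formula $$\exists e^0.\forall s^0.\ \exists e^1.\forall s^1.\ \cdots\ \exists e^{k-1}.\forall s^{k-1}.\ \neg[\varphi_{\mathbb B}]^{0,k}$$ is satisfiable (i.e. true), then $\varphi_{\mathbb B}$ is unrealizable.
   Context: Fix a first-order theory $\mathcal T$ interpreted in its intended structure, a finite tuple $x$ of environment variables and a finite tuple $y$ of system variables. $\mathrm{LTL}_{\mathcal T}$ formulae are LTL formulae (Booleans, next $\bigcirc$, until $\mathcal U$, derived operators such as always $\square$ and release $\mathcal R$) whose atoms are literals $l(x,y)$ of $\mathcal T$ over the variables of the current instant. Boolean abstraction: let $l_1,\dots,l_n$ be the literals (atoms) of $\varphi$ and $s=(s_1,\dots,s_n)$ fresh Boolean system variables. A choice is a set $c\subseteq\{1,\dots,n\}$; write $c(x,y)=\bigwedge_{i\in c}l_i\wedge\bigwedge_{i\notin c}\neg l_i$ and $c^s=\bigwedge_{i\in c}s_i\wedge\bigwedge_{i\notin c}\neg s_i$. A reaction is a set $R$ of choices, with $r_R(x)=\bigwedge_{c\in R}\exists y\,c(x,y)\wedge\bigwedge_{c\notin R}\neg\exists y\,c(x,y)$; $R$ is valid if $\exists x\,r_R(x)$ holds in $\mathcal T$. Let $R_1,\dots,R_m$ be the valid reactions and $e=(e_1,\dots,e_m)$ fresh Boolean environment variables.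 Then $\varphi_{\mathbb B}=\varphi[l_i\leftarrow s_i]\wedge\square\big(\text{exactly one of }e_1,\dots,e_m\text{ is true}\rightarrow\bigwedge_{j=1}^m(e_j\rightarrow\bigvee_{c\in R_j}c^s)\big)$, an LTL formula. Realizability of $\varphi_{\mathbb B}$: in each turn $i=0,1,2,\dots$ the environment picks a Boolean valuation $e^i$ of $e$, then the system picks a Boolean valuation $s^i$ of $s$. A system strategy determines $s^i$ from $e^0,\dots,e^i$; it is winning if every resulting infinite trace satisfies $\varphi_{\mathbb B}$. $\varphi_{\mathbb B}$ is unrealizable if the system has no winning strategy. Unrolling: put the formula in negation normal form (negations only on atoms; operators $\wedge,\vee,\bigcirc,\mathcal U,\mathcal R$, with $\square\psi=\bot\,\mathcal R\,\psi$). For $k\ge1$ and copies $e^0,\dots,e^{k-1},s^0,\dots,s^{k-1}$ of the variables define $[\psi]^{i,k}$ by: $[\psi]^{i,k}=\top$ if $i\ge k$; and for $i<k$, a (possibly negated) atom is replaced by its copy at instant $i$; $[\cdot]^{i,k}$ commutes with $\wedge,\vee$ and the constants; $[\bigcirc\psi]^{i,k}=[\psi]^{i+1,k}$; $[\psi_1\,\mathcal U\,\psi_2]^{i,k}=[\psi_2]^{i,k}\vee([\psi_1]^{i,k}\wedge[\psi_1\,\mathcal U\,\psi_2]^{i+1,k})$; $[\psi_1\,\mathcal R\,\psi_2]^{i,k}=[\psi_2]^{i,k}\wedge([\psi_1]^{i,k}\vee[\psi_1\,\mathcal R\,\psi_2]^{i+1,k})$. -}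

module Defs where

open import Level using (Level; 0ℓ; _⊔_) renaming (suc to lsuc)
open import Data.Bool.Base as 𝔹 using (Bool; true; false; T; if_then_else_)
open import Data.Fin.Base using (Fin; fromℕ<; toℕ)
open import Data.Fin.Properties using (_≟_)
open import Data.Fin.Subset using (Subset; inside; outside)
open import Data.List.Base as List
  using (List; []; _∷_; _++_; [_]; map; foldr; filterᵇ; allFin; length)
open import Data.List.Membership.Propositional using (_∈_)
import Data.List.Membership.Setoid as SetoidMembership
open import Data.List.Membership.Propositional.Properties using (∈-++⁺ˡ; ∈-++⁺ʳ)
open import Data.List.Relation.Unary.Any using (here; index)
import Data.List.Relation.Unary.Unique.Setoid as SetoidUnique
open import Data.Nat.Base using (ℕ; zero; suc; _+_; _≤_; _<_; _≤‴_; ≤‴-reflexive; ≤‴-step)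
open import Data.Nat.Properties using (_≤?_; ≤⇒≤‴; ≤‴⇒≤)
open import Data.Product.Base using (Σ-syntax; ∃-syntax; _×_; _,_)
open import Data.Sum.Base using (_⊎_; inj₁; inj₂; [_,_]′)
import Data.Unit.Polymorphic.Base as Unit
open import Data.Vec.Base as Vec using (Vec; []; _∷_; lookup; tabulate)
open import Data.Vec.Relation.Binary.Pointwise.Inductive using (Pointwise)
open import Function.Base using (_∘_)
open import Function.Bundles using (_⇔_)
open import Relation.Binary.Bundles using (Setoid)
open import Relation.Binary.PropositionalEquality using (_≡_; refl; setoid; _→-setoid_)
open import Relation.Nullary.Decidable.Core using (⌊_⌋; yes; no)
open import Relation.Nullary.Negation.Core using () renaming (¬_ to Not_)

infixr 7 _∧_
infixr 6 _∨_
infixr 5 _⇒_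
infix  9 ∼_ ○_ □_
infixr 8 _U_ _R_

record Signature : Set₁ where
  field
    Fun    : Set
    Rel    : Set
    arityF : Fun → ℕ
    arityR : Rel → ℕ

module _ (S : Signature) where
  open Signature S

  infix  8 _≐_
  infix  9 ∼_
  infixr 7 _∧_

  -- Variables are de Bruijn indices: v is the number of free variables.
  data Term (v : ℕ) : Set where
    var : Fin v → Term v
    fun : (f : Fun) → Vec (Term v) (arityF f) → Term v

  data Atom (v : ℕ) : Set where
    _≐_ : Term v → Term v → Atom v
    rel : (r : Rel) → Vec (Term v) (arityR r) → Atom v

  data Literal (v : ℕ) : Set where
    pos neg : Atom v → Literal v

  data Formula (v : ℕ) : Set where
    atom : Atom v → Formula v
    ⊤    : Formula v
    ∼_   : Formula v → Formula v
    _∧_  : Formula v → Formula v → Formula v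
    ex   : Formula (suc v) → Formula v

  Sentence : Set
  Sentence = Formula 0

  -- A setoid carrier, so that quotient domains (such as the reals) are allowed.
  record Structure (c ℓ : Level) : Set (lsuc (c ⊔ ℓ)) where
    field
      domain : Setoid c ℓ
    open Setoid domain public renaming (Carrier to Dom)
    field
      point    : Dom
      ⟦_⟧F     : (f : Fun) → Vec Dom (arityF f) → Dom
      ⟦_⟧R     : (r : Rel) → Vec Dom (arityR r) → Set ℓ
      ⟦_⟧F-cong : ∀ f {ds ds′} → Pointwise _≈_ ds ds′ → ⟦ f ⟧F ds ≈ ⟦ f ⟧F ds′
      ⟦_⟧R-cong : ∀ r {ds ds′} → Pointwise _≈_ ds ds′ → ⟦ r ⟧R ds → ⟦ r ⟧R ds′

module _ {S : Signature} {c ℓ : Level} (M : Structure S c ℓ) where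
  open Signature S
  open Structure M

  mutual
    evalTerm : ∀ {v} → Vec Dom v → Term S v → Dom
    evalTerm ρ (var i)    = lookup ρ i
    evalTerm ρ (fun f ts) = ⟦ f ⟧F (evalTerms ρ ts)

    evalTerms : ∀ {v n} → Vec Dom v → Vec (Term S v) n → Vec Dom n
    evalTerms ρ []       = []
    evalTerms ρ (t ∷ ts) = evalTerm ρ t ∷ evalTerms ρ ts

  HoldsAtom : ∀ {v} → Vec Dom v → Atom S v → Set ℓ
  HoldsAtom ρ (t ≐ u)    = evalTerm ρ t ≈ evalTerm ρ u
  HoldsAtom ρ (rel r ts) = ⟦ r ⟧R (evalTerms ρ ts)

  Holds : ∀ {v} → Vec Dom v → Formula S v → Set (c ⊔ ℓ)
  Holds ρ (atom a) = Level.Lift c (HoldsAtom ρ a)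
  Holds ρ ⊤        = Unit.⊤
  Holds ρ (∼ ψ)    = Not Holds ρ ψ
  Holds ρ (ψ ∧ χ)  = Holds ρ ψ × Holds ρ χ
  Holds ρ (ex ψ)   = ∃[ d ] Holds (d ∷ ρ) ψ

record Theory (S : Signature) (c ℓ : Level) : Set (lsuc (c ⊔ ℓ)) where
  field
    Axiom    : Sentence S → Set
    intended : Structure S c ℓ
    isModel  : ∀ {σ} → Axiom σ → Holds intended [] σ

module _ {S : Signature} where

  literal : ∀ {v} → Literal S v → Formula S v
  literal (pos a) = atom a
  literal (neg a) = ∼ atom a

  conjunction : ∀ {v} → List (Formula S v) → Formula S v
  conjunction = foldr _∧_ ⊤

  -- Existentially quantifies the first m variables.
  exists : ∀ m {v} → Formula S (m + v) → Formula S v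
  exists zero    ψ = ψ
  exists (suc m) ψ = exists m (ex ψ)

  existsAll : ∀ {v} → Formula S v → Sentence S
  existsAll {zero}  ψ = ψ
  existsAll {suc v} ψ = existsAll (ex ψ)

data LTL (A : Set) : Set where
  ⊤       : LTL A
  atom    : A → LTL A
  ∼_ ○_   : LTL A → LTL A
  _∧_ _∨_ : LTL A → LTL A → LTL A
  _U_     : LTL A → LTL A → LTL A

falsum : ∀ {A} → LTL A
falsum = ∼ ⊤

_⇒_ : ∀ {A} → LTL A → LTL A → LTL A
ψ ⇒ χ = ∼ ψ ∨ χ

_R_ : ∀ {A} → LTL A → LTL A → LTL A
ψ R χ = ∼ (∼ ψ U ∼ χ)

□_ : ∀ {A} → LTL A → LTL A
□ ψ = falsum R ψ

⋀ ⋁ : ∀ {A} → List (LTL A) → LTL A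
⋀ = foldr _∧_ ⊤
⋁ = foldr _∨_ falsum

-- Satisfaction at instant i, where w j a tells whether atom a is true at j.
Sat : ∀ {A} → (ℕ → A → Bool) → ℕ → LTL A → Set
Sat w i ⊤        = Unit.⊤
Sat w i (atom a) = T (w i a)
Sat w i (∼ ψ)    = Not Sat w i ψ
Sat w i (○ ψ)    = Sat w (suc i) ψ
Sat w i (ψ ∧ χ)  = Sat w i ψ × Sat w i χ
Sat w i (ψ ∨ χ)  = Sat w i ψ ⊎ Sat w i χ
Sat w i (ψ U χ)  =
  ∃[ j ] i ≤ j × Sat w j χ × (∀ l → i ≤ l → l < j → Sat w l ψ)

atoms : ∀ {A} → LTL A → List A
atoms ⊤        = []
atoms (atom a) = [ a ]
atoms (∼ ψ)    = atoms ψ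
atoms (○ ψ)    = atoms ψ
atoms (ψ ∧ χ)  = atoms ψ ++ atoms χ
atoms (ψ ∨ χ)  = atoms ψ ++ atoms χ
atoms (ψ U χ)  = atoms ψ ++ atoms χ

mapAtoms : ∀ {A B} (ψ : LTL A) → (∀ {a} → a ∈ atoms ψ → B) → LTL B
mapAtoms ⊤        f = ⊤
mapAtoms (atom a) f = atom (f (here refl))
mapAtoms (∼ ψ)    f = ∼ mapAtoms ψ f
mapAtoms (○ ψ)    f = ○ mapAtoms ψ f
mapAtoms (ψ ∧ χ)  f = mapAtoms ψ (f ∘ ∈-++⁺ˡ) ∧ mapAtoms χ (f ∘ ∈-++⁺ʳ (atoms ψ))
mapAtoms (ψ ∨ χ)  f = mapAtoms ψ (f ∘ ∈-++⁺ˡ) ∨ mapAtoms χ (f ∘ ∈-++⁺ʳ (atoms ψ))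
mapAtoms (ψ U χ)  f = mapAtoms ψ (f ∘ ∈-++⁺ˡ) U mapAtoms χ (f ∘ ∈-++⁺ʳ (atoms ψ))

-- Formulae whose atoms are literals over the nx environment variables x and
-- the ny system variables y; the indices of y come before those of x.
LTLT : Signature → (nx ny : ℕ) → Set
LTLT S nx ny = LTL (Literal S (ny + nx))

-- xs lists the elements satisfying P, up to the setoid equality and without
-- repetition.
record Enumerates {a ℓ p} (X : Setoid a ℓ) (P : Setoid.Carrier X → Set p)
                  (xs : List (Setoid.Carrier X)) : Set (a ⊔ ℓ ⊔ p) where
  field
    distinct : SetoidUnique.Unique X xs
    exact    : ∀ x → SetoidMembership._∈_ X x xs ⇔ P x

Choice : ℕ → Set
Choice n = Subset n

choices : ∀ n → List (Choice n)
choices zero    = [ [] ]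
choices (suc n) = map (inside ∷_) (choices n) ++ map (outside ∷_) (choices n)

-- A set of choices is given by its characteristic function, and two such sets
-- are equal when these functions agree pointwise.
Reaction : ℕ → Set
Reaction n = Choice n → Bool

reactionSetoid : ℕ → Setoid 0ℓ 0ℓ
reactionSetoid n = Choice n →-setoid Bool

_holding _failing : ∀ {n} → Reaction n → List (Choice n)
_holding {n} r = filterᵇ r (choices n)
_failing {n} r = filterᵇ (𝔹.not ∘ r) (choices n)

module _ {S : Signature} {nx ny : ℕ} (ls : List (Literal S (ny + nx))) where

  choiceFormula : Choice (length ls) → Formula S (ny + nx)
  choiceFormula c = conjunction (map conjunct (allFin (length ls)))
    where
    conjunct : Fin (length ls) → Formula S (ny + nx)
    conjunct i = if lookup c i then literal (List.lookup ls i)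
                               else ∼ literal (List.lookup ls i)

  reactionFormula : Reaction (length ls) → Formula S nx
  reactionFormula r =
    conjunction (map (λ c → exists ny (choiceFormula c)) (r holding))
    ∧ conjunction (map (λ c → ∼ exists ny (choiceFormula c)) (r failing))

ValidReaction : ∀ {S c ℓ} → Theory S c ℓ → (nx ny : ℕ) (ls : List (Literal S (ny + nx))) →
                Reaction (length ls) → Set (c ⊔ ℓ)
ValidReaction 𝒯 nx ny ls r =
  Holds (Theory.intended 𝒯) [] (existsAll (reactionFormula {nx = nx} {ny} ls r))

-- inj₁ j is the environment variable e_j, inj₂ i the system variable s_i.
BVar : (m n : ℕ) → Set
BVar m n = Fin m ⊎ Fin n

module _ {m n : ℕ} where

  e : Fin m → LTL (BVar m n)
  e j = atom (inj₁ j)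

  s : Fin n → LTL (BVar m n)
  s i = atom (inj₂ i)

  exactlyOne : LTL (BVar m n)
  exactlyOne = ⋁ (map onlyE (allFin m))
    where
    onlyE : Fin m → LTL (BVar m n)
    onlyE j = ⋀ (map (λ j′ → if ⌊ j′ ≟ j ⌋ then e j′ else ∼ e j′) (allFin m))

  choiceˢ : Choice n → LTL (BVar m n)
  choiceˢ c = ⋀ (map (λ i → if lookup c i then s i else ∼ s i) (allFin n))

module _ {A : Set} (φ : LTL A) (ls : List A) (covers : ∀ {l} → l ∈ atoms φ → l ∈ ls)
         (Rs : List (Reaction (length ls))) where

  booleanAbstraction : LTL (BVar (length Rs) (length ls))
  booleanAbstraction =
    mapAtoms φ (λ l∈φ → inj₂ (index (covers l∈φ)))
    ∧ □ (exactlyOne ⇒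
         ⋀ (map (λ j → e j ⇒ ⋁ (map choiceˢ (List.lookup Rs j holding)))
                (allFin (length Rs))))

Valuation : (m n : ℕ) → Set
Valuation m n = Vec Bool m × Vec Bool n

value : ∀ {m n} → Valuation m n → BVar m n → Bool
value (es , ss) = [ lookup es , lookup ss ]′

-- The system's answer in turn i, as a function of e⁰, …, eⁱ.
Strategy : (m n : ℕ) → Set
Strategy m n = ∀ i → Vec (Vec Bool m) (suc i) → Vec Bool n

play : ∀ {m n} → Strategy m n → (ℕ → Vec Bool m) → ℕ → Valuation m n
play f env i = env i , f i (tabulate (env ∘ toℕ))

Winning : ∀ {m n} → LTL (BVar m n) → Strategy m n → Set
Winning ψ f = ∀ env → Sat (value ∘ play f env) 0 ψ

Unrealizable : ∀ {m n} → LTL (BVar m n) → Set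
Unrealizable {m} {n} ψ = Not (Σ[ f ∈ Strategy m n ] Winning ψ f)

data NNF (A : Set) : Set where
  ⊤ ⊥       : NNF A
  pos neg   : A → NNF A
  _∧_ _∨_   : NNF A → NNF A → NNF A
  ○_        : NNF A → NNF A
  _𝒰_ _ℛ_   : NNF A → NNF A → NNF A

mutual
  nnf : ∀ {A} → LTL A → NNF A
  nnf ⊤        = ⊤
  nnf (atom a) = pos a
  nnf (∼ ψ)    = nnf∼ ψ
  nnf (○ ψ)    = ○ nnf ψ
  nnf (ψ ∧ χ)  = nnf ψ ∧ nnf χ
  nnf (ψ ∨ χ)  = nnf ψ ∨ nnf χ
  nnf (ψ U χ)  = nnf ψ 𝒰 nnf χ

  nnf∼ : ∀ {A} → LTL A → NNF A
  nnf∼ ⊤        = ⊥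
  nnf∼ (atom a) = neg a
  nnf∼ (∼ ψ)    = nnf ψ
  nnf∼ (○ ψ)    = ○ nnf∼ ψ
  nnf∼ (ψ ∧ χ)  = nnf∼ ψ ∨ nnf∼ χ
  nnf∼ (ψ ∨ χ)  = nnf∼ ψ ∧ nnf∼ χ
  nnf∼ (ψ U χ)  = nnf∼ ψ ℛ nnf∼ χ

data Propositional (V : Set) : Set where
  ⊤ ⊥     : Propositional V
  var     : V → Propositional V
  ∼_      : Propositional V → Propositional V
  _∧_ _∨_ : Propositional V → Propositional V → Propositional V

eval : ∀ {V} → (V → Bool) → Propositional V → Bool
eval ρ ⊤       = true
eval ρ ⊥       = false
eval ρ (var v) = ρ v
eval ρ (∼ ψ)   = 𝔹.not (eval ρ ψ)
eval ρ (ψ ∧ χ) = eval ρ ψ 𝔹.∧ eval ρ χ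
eval ρ (ψ ∨ χ) = eval ρ ψ 𝔹.∨ eval ρ χ

-- The variable (i , a) is the copy of a at instant i.
unroll : ∀ {A i k} → NNF A → i ≤‴ k → Propositional (Fin k × A)
unroll ψ       (≤‴-reflexive _)  = ⊤
unroll ⊤       (≤‴-step i<k)     = ⊤
unroll ⊥       (≤‴-step i<k)     = ⊥
unroll (pos a) (≤‴-step i<k)     = var (fromℕ< (≤‴⇒≤ i<k) , a)
unroll (neg a) (≤‴-step i<k)     = ∼ var (fromℕ< (≤‴⇒≤ i<k) , a)
unroll (ψ ∧ χ) p@(≤‴-step i<k)   = unroll ψ p ∧ unroll χ p
unroll (ψ ∨ χ) p@(≤‴-step i<k)   = unroll ψ p ∨ unroll χ p
unroll (○ ψ)   (≤‴-step i<k)     = unroll ψ i<k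
unroll (ψ 𝒰 χ) p@(≤‴-step i<k)   = unroll χ p ∨ (unroll ψ p ∧ unroll (ψ 𝒰 χ) i<k)
unroll (ψ ℛ χ) p@(≤‴-step i<k)   = unroll χ p ∧ (unroll ψ p ∨ unroll (ψ ℛ χ) i<k)

⟦_⟧^_,_ : ∀ {A} → NNF A → (i k : ℕ) → Propositional (Fin k × A)
⟦ ψ ⟧^ i , k with i ≤? k
... | yes i≤k = unroll ψ (≤⇒≤‴ i≤k)
... | no  _   = ⊤

-- ∃ e⁰ ∀ s⁰ … ∃ eᵏ⁻¹ ∀ sᵏ⁻¹, over a predicate on the k chosen valuations.
Alternating : ∀ {m n} k → (Vec (Valuation m n) k → Set) → Set
Alternating zero    P = P []
Alternating (suc k) P = ∃[ es ] ∀ ss → Alternating k (λ w → P ((es , ss) ∷ w))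

∃∀-true : ∀ {m n} k → Propositional (Fin k × BVar m n) → Set
∃∀-true k θ = Alternating k (λ w → T (eval (λ (i , a) → value (lookup w i) a) θ))

{-# OPTIONS --safe #-}

-- A winning strategy of the system is played against the environment choices
-- read off the true QBF; the trace obtained satisfies φ𝔹. Unrolling weakens
-- the formula, since everything beyond instant k becomes true, so the
-- valuations of the first k turns satisfy [φ𝔹]^{0,k} as well, contradicting
-- the matrix of the QBF. Negation normal form relies on classical dualities,
-- but the unrolled formula is Boolean, hence decidable, and so double negations
-- can be removed from its truth.
module Submission where

open import Defs
open import Level using (Level)
open import Data.Bool.Base using (Bool; true; false; T; not)
import Data.Bool.Base as Bool
open import Data.Bool.Properties using (T?; T-∧; T-∨)
open import Data.Fin.Base using (Fin; toℕ; fromℕ<)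
open import Data.Fin.Properties using (toℕ-fromℕ<)
open import Data.List.Base using (List; length)
open import Data.List.Membership.Propositional using (_∈_)
open import Data.Nat.Base using (ℕ; zero; suc; _+_; _≤_; _<_; _≤‴_; ≤‴-reflexive; ≤‴-step)
open import Data.Nat.Properties using (_≤?_; ≤⇒≤‴; ≤‴⇒≤; ≤-refl; <⇒≤; ≤⇒≯; m≤n⇒m<n∨m≡n)
open import Data.Product.Base using (Σ-syntax; ∃-syntax; _×_; _,_)
open import Data.Sum.Base using (_⊎_; inj₁; inj₂)
import Data.Sum.Base as Sum
open import Data.Unit.Base using (tt)
open import Data.Vec.Base using (Vec; []; _∷_; lookup; replicate; tabulate)
open import Data.Vec.Properties using (lookup∘tabulate)
open import Function.Base using (_∘_)
open import Function.Bundles using (Equivalence)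
open import Relation.Binary.PropositionalEquality
  using (_≡_; refl; sym; trans; cong; subst; setoid)
open import Relation.Nullary.Decidable using (yes; no; decidable-stable)
open import Relation.Nullary.Negation using (¬_; contradiction)

T-∧⁺ : ∀ {a b} → T a → T b → T (a Bool.∧ b)
T-∧⁺ p q = Equivalence.from T-∧ (p , q)

T-not⁺ : ∀ {a} → ¬ T a → T (not a)
T-not⁺ {true}  ¬p = ¬p tt
T-not⁺ {false} _  = tt

T-not⁻ : ∀ {a} → T (not a) → ¬ T a
T-not⁻ {false} _ ()

-- `A` and `B` need not be decidable. The Boolean goal is, so it may be assumed false, and a proof
-- of `A` together with one of `B` then yields the contradiction.
T-∨-deMorgan : ∀ {a b} {A B : Set} → (¬ A → T a) → (¬ B → T b) → ¬ (A × B) → T (a Bool.∨ b)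
T-∨-deMorgan {a} {b} f g ¬AB = decidable-stable (T? (a Bool.∨ b)) λ ¬a∨b →
  ¬a∨b (Equivalence.from T-∨ (inj₁ (f λ x →
    ¬a∨b (Equivalence.from T-∨ (inj₂ (g λ y → ¬AB (x , y)))))))

module _ {A : Set} {w : ℕ → A → Bool} {ψ χ : LTL A} {i : ℕ} where

  U-now : Sat w i χ → Sat w i (ψ U χ)
  U-now χᵢ = i , ≤-refl , χᵢ , λ l i≤l l<i → contradiction l<i (≤⇒≯ i≤l)

  U-later : Sat w i ψ → Sat w (suc i) (ψ U χ) → Sat w i (ψ U χ)
  U-later ψᵢ (j , i<j , χⱼ , ψ<j) = j , <⇒≤ i<j , χⱼ , until
    where
    until : ∀ l → i ≤ l → l < j → Sat w l ψ
    until l i≤l l<j with m≤n⇒m<n∨m≡n i≤l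
    ... | inj₁ i<l  = ψ<j l i<l l<j
    ... | inj₂ refl = ψᵢ

  U-split : Sat w i (ψ U χ) → Sat w i χ ⊎ (Sat w i ψ × Sat w (suc i) (ψ U χ))
  U-split (j , i≤j , χⱼ , ψ<j) with m≤n⇒m<n∨m≡n i≤j
  ... | inj₁ i<j  = inj₂ (ψ<j i ≤-refl i<j , j , i<j , χⱼ , λ l i<l → ψ<j l (<⇒≤ i<l))
  ... | inj₂ refl = inj₁ χⱼ

module _ {A : Set} {k : ℕ} {w : ℕ → A → Bool} {ρ : Fin k × A → Bool}
         (agree : ∀ i a → ρ (i , a) ≡ w (toℕ i) a) where

  ρ-fromℕ< : ∀ {i} (i<k : i < k) a → ρ (fromℕ< i<k , a) ≡ w i a
  ρ-fromℕ< i<k a =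
    trans (agree (fromℕ< i<k) a) (cong (λ j → w j a) (toℕ-fromℕ< i<k))

  mutual
    -- Until unfolds to the same formula one instant later, so the recursion descends on `p` there
    -- and on the formula elsewhere. The converse fails: an until may be postponed past `k`.
    unroll-nnf : ∀ ψ {i} (p : i ≤‴ k) → Sat w i ψ → T (eval ρ (unroll (nnf ψ) p))
    unroll-nnf ψ        (≤‴-reflexive _) h = tt
    unroll-nnf ⊤        (≤‴-step i<k) h = tt
    unroll-nnf (atom a) (≤‴-step i<k) h = subst T (sym (ρ-fromℕ< (≤‴⇒≤ i<k) a)) h
    unroll-nnf (∼ ψ)    p@(≤‴-step _) h = unroll-nnf∼ ψ p h
    unroll-nnf (○ ψ)    (≤‴-step i<k) h = unroll-nnf ψ i<k h
    unroll-nnf (ψ ∧ χ)  p@(≤‴-step _) (h , h′) =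
      T-∧⁺ (unroll-nnf ψ p h) (unroll-nnf χ p h′)
    unroll-nnf (ψ ∨ χ)  p@(≤‴-step _) h =
      Equivalence.from T-∨ (Sum.map (unroll-nnf ψ p) (unroll-nnf χ p) h)
    unroll-nnf (ψ U χ)  p@(≤‴-step i<k) h = Equivalence.from T-∨ (Sum.map
      (unroll-nnf χ p)
      (λ (ψᵢ , later) → T-∧⁺ (unroll-nnf ψ p ψᵢ) (unroll-nnf (ψ U χ) i<k later))
      (U-split {ψ = ψ} {χ} h))

    -- The hypothesis is a bare refutation, matching how `nnf∼` pushes negation inwards. The release
    -- case uses the contrapositives of `U-now` and `U-later`.
    unroll-nnf∼ : ∀ ψ {i} (p : i ≤‴ k) → ¬ Sat w i ψ → T (eval ρ (unroll (nnf∼ ψ) p))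
    unroll-nnf∼ ψ        (≤‴-reflexive _) h = tt
    unroll-nnf∼ ⊤        (≤‴-step i<k) h = contradiction _ h
    unroll-nnf∼ (atom a) (≤‴-step i<k) h =
      T-not⁺ (h ∘ subst T (ρ-fromℕ< (≤‴⇒≤ i<k) a))
    unroll-nnf∼ (∼ ψ)    p@(≤‴-step _) h =
      -- Here `h` is a double negation of `Sat w i ψ`; it is removed from the Boolean goal instead.
      decidable-stable (T? _) λ ¬t → h (¬t ∘ unroll-nnf ψ p)
    unroll-nnf∼ (○ ψ)    (≤‴-step i<k) h = unroll-nnf∼ ψ i<k h
    unroll-nnf∼ (ψ ∧ χ)  p@(≤‴-step _) h =
      T-∨-deMorgan (unroll-nnf∼ ψ p) (unroll-nnf∼ χ p) h
    unroll-nnf∼ (ψ ∨ χ)  p@(≤‴-step _) h =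
      T-∧⁺ (unroll-nnf∼ ψ p (h ∘ inj₁)) (unroll-nnf∼ χ p (h ∘ inj₂))
    unroll-nnf∼ (ψ U χ)  p@(≤‴-step i<k) h =
      T-∧⁺ (unroll-nnf∼ χ p (h ∘ U-now {ψ = ψ} {χ}))
           (T-∨-deMorgan (unroll-nnf∼ ψ p) (unroll-nnf∼ (ψ U χ) i<k)
             λ (ψᵢ , later) → h (U-later {ψ = ψ} {χ} ψᵢ later))

  Sat⇒unrolling : ∀ ψ i → Sat w i ψ → T (eval ρ (⟦ nnf ψ ⟧^ i , k))
  Sat⇒unrolling ψ i h with i ≤? k
  ... | yes i≤k = unroll-nnf ψ (≤⇒≤‴ i≤k) h
  ... | no  _   = tt

module _ {m n : ℕ} where

  infixr 5 _◂_

  _◂_ : Vec Bool m → (ℕ → Vec Bool m) → ℕ → Vec Bool m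
  (es ◂ env) zero    = es
  (es ◂ env) (suc i) = env i

  -- What `f` becomes once `es` has been played as the first environment move.
  residual : Vec Bool m → Strategy m n → Strategy m n
  residual es f i history = f (suc i) (es ∷ history)

  -- Each existential move may depend on earlier answers of the system, but `f` fixes these, so by
  -- induction on `k` the moves collapse to one sequence.
  counterplay : ∀ k {P : Vec (Valuation m n) k → Set} → Alternating k P → (f : Strategy m n) →
                Σ[ env ∈ (ℕ → Vec Bool m) ] P (tabulate (play f env ∘ toℕ))
  -- Moves from turn `k` on are arbitrary; all-false is a default.
  counterplay zero    P[]           f = (λ _ → replicate m false) , P[]
  counterplay (suc k) (es , answer) f =
    let env , win = counterplay k (answer (f 0 (es ∷ []))) (residual es f)
    -- Playing `f` against `es ◂ env` from turn 1 on is, definitionally, playing `residual es f`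
    -- against `env`.
    in  es ◂ env , win

  ∃∀-unrolling⇒Unrealizable : ∀ (ψ : LTL (BVar m n)) k →
    ∃∀-true k (∼ (⟦ nnf ψ ⟧^ 0 , k)) → Unrealizable ψ
  ∃∀-unrolling⇒Unrealizable ψ k alternating (f , winning) =
    let env , refuted = counterplay k alternating f
    in  T-not⁻ refuted
          (Sat⇒unrolling {k = k}
            -- The QBF reads the first `k` turns from a vector tabulated from the infinite play.
            (λ i a → cong (λ v → value v a) (lookup∘tabulate (play f env ∘ toℕ) i))
            ψ 0 (winning env))

theorem6 : ∀ {c ℓ : Level} (S : Signature) (𝒯 : Theory S c ℓ) (nx ny : ℕ) (φ : LTLT S nx ny)
    (ls : List (Literal S (ny + nx)))
    (ls-literals : Enumerates (setoid (Literal S (ny + nx))) (λ l → l ∈ atoms φ) ls)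
    (Rs : List (Reaction (length ls)))
    (Rs-valid : Enumerates (reactionSetoid (length ls)) (ValidReaction 𝒯 nx ny ls) Rs) →
    let φ𝔹 = booleanAbstraction φ ls (Equivalence.from (Enumerates.exact ls-literals _)) Rs in
    ∃[ k ] (1 ≤ k × ∃∀-true k (∼ (⟦ nnf φ𝔹 ⟧^ 0 , k))) →
    Unrealizable φ𝔹
theorem6 S 𝒯 nx ny φ ls ls-literals Rs Rs-valid (k , _ , alternating) =
  ∃∀-unrolling⇒Unrealizable
    (booleanAbstraction φ ls (Equivalence.from (Enumerates.exact ls-literals _)) Rs) k alternating
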